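{- For every integer $n\ge 0$, $$x\prod_{i=0}^{n}\bigl(1+tx^{2^{i}}+x^{2^{i+1}}\bigr)=\sum_{i=1}^{2^{n+1}}\Bigl(B_i(t)+B_{2^{n+1}-i}(t)\,x^{2^{n+1}}\Bigr)x^{i}$$ as an identity in $\mathbb{Z}[t,x]$.
   Context: The Stern polynomials $B_n(t)\in\mathbb{Z}[t]$, $n\ge 0$, are defined by $B_0(t)=0$, $B_1(t)=1$, $B_{2n}(t)=tB_n(t)$ and $B_{2n+1}(t)=B_n(t)+B_{n+1}(t)$ for $n\ge 1$. -}

module Defs where

open import Level using (Level)
open import Algebra.Bundles.Raw using (RawRing)
open import Data.Fin.Base using (toℕ)
import Data.Integer.Base as ℤ
open import Data.List.Base using (List; []; _∷_; map)
open import Data.Nat.Base as ℕ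
  using (ℕ; zero; suc; _<_; ⌊_/2⌋; ⌈_/2⌉; parity; NonZero)
open import Data.Nat.Induction using (<-rec; <-wellFounded)
open import Data.Nat.Properties using (⌊n/2⌋<n; ⌈n/2⌉<n; +-identityʳ; +-suc)
open import Data.Parity.Base using (0ℙ; 1ℙ)
import Algebra.Definitions.RawSemiring as RawSemiringDefs
import Induction.WellFounded as WF
open import Relation.Binary.PropositionalEquality
  using (_≡_; refl; sym; trans; cong; cong₂; module ≡-Reasoning)

-- Univariate polynomials over R, as lists of coefficients with the
-- constant term first. The representation is not unique (trailing zeros
-- are allowed), so equality is equality of all coefficients.

module Polynomial {c ℓ : Level} (R : RawRing c ℓ) where
  private module R = RawRing R

  Poly : Set c
  Poly = List R.Carrier

  coeff : Poly → ℕ → R.Carrier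
  coeff []      _       = R.0#
  coeff (a ∷ p) zero    = a
  coeff (a ∷ p) (suc k) = coeff p k

  infix  4 _≈_
  infixl 6 _+_
  infixl 7 _*_

  _≈_ : Poly → Poly → Set ℓ
  p ≈ q = ∀ k → coeff p k R.≈ coeff q k

  _+_ : Poly → Poly → Poly
  []      + q       = q
  (a ∷ p) + []      = a ∷ p
  (a ∷ p) + (b ∷ q) = (a R.+ b) ∷ (p + q)

  -- (a + X p) q = a q + X (p q)
  _*_ : Poly → Poly → Poly
  []      * q = []
  (a ∷ p) * q = map (a R.*_) q + (R.0# ∷ p * q)

  constant : R.Carrier → Poly
  constant a = a ∷ []

  indeterminate : Poly
  indeterminate = R.0# ∷ R.1# ∷ []

  rawRing : RawRing c ℓ
  rawRing = record
    { Carrier = Poly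
    ; _≈_     = _≈_
    ; _+_     = _+_
    ; _*_     = _*_
    ; -_      = map R.-_
    ; 0#      = []
    ; 1#      = constant R.1#
    }

module ℤ[t]   = Polynomial ℤ.+-*-rawRing
module ℤ[t,x] = Polynomial ℤ[t].rawRing

ℤ[t] : Set
ℤ[t] = ℤ[t].Poly

ℤ[t,x] : Set
ℤ[t,x] = ℤ[t,x].Poly

-- For odd n = 2m+1, ⌊ n /2⌋ = m and ⌈ n /2⌉ = m+1.
sternStep : ∀ n → (∀ {m} → m < n → ℤ[t]) → ℤ[t]
sternStep 0 B = RawRing.0# ℤ[t].rawRing
sternStep 1 B = RawRing.1# ℤ[t].rawRing
sternStep n@(suc (suc k)) B with parity n
... | 0ℙ = ℤ[t].indeterminate ℤ[t].* B {⌊ n /2⌋} (⌊n/2⌋<n (suc k))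
... | 1ℙ = B {⌊ n /2⌋} (⌊n/2⌋<n (suc k)) ℤ[t].+ B {⌈ n /2⌉} (⌈n/2⌉<n k)

stern : ℕ → ℤ[t]
stern = <-rec (λ _ → ℤ[t]) sternStep

private
  sternStep-ext : ∀ n {B B′ : ∀ {m} → m < n → ℤ[t]} →
                  (∀ {m} (m<n : m < n) → B m<n ≡ B′ m<n) →
                  sternStep n B ≡ sternStep n B′
  sternStep-ext 0 eq = refl
  sternStep-ext 1 eq = refl
  sternStep-ext n@(suc (suc k)) eq with parity n
  ... | 0ℙ = cong (ℤ[t].indeterminate ℤ[t].*_) (eq _)
  ... | 1ℙ = cong₂ ℤ[t]._+_ (eq _) (eq _)

  stern-unfold : ∀ n → stern n ≡ sternStep n (λ {m} _ → stern m)
  stern-unfold n = WF.FixPoint.unfold-wfRec <-wellFounded (λ _ → ℤ[t])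
    sternStep (λ m eq → sternStep-ext m (λ l<m → eq l<m)) {n}

  double : ∀ n → 2 ℕ.* n ≡ n ℕ.+ n
  double n = cong (n ℕ.+_) (+-identityʳ n)

  parity-even : ∀ n → parity (n ℕ.+ n) ≡ 0ℙ
  parity-even zero    = refl
  parity-even (suc n) = trans (cong (λ m → parity (suc m)) (+-suc n n)) (parity-even n)

  parity-odd : ∀ n → parity (suc (n ℕ.+ n)) ≡ 1ℙ
  parity-odd zero    = refl
  parity-odd (suc n) = trans (cong (λ m → parity (suc (suc m))) (+-suc n n)) (parity-odd n)

  half-even : ∀ n → ⌊ n ℕ.+ n /2⌋ ≡ n
  half-even zero    = refl
  half-even (suc n) = trans (cong (λ m → ⌊ suc m /2⌋) (+-suc n n)) (cong suc (half-even n))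

  half-odd : ∀ n → ⌊ suc (n ℕ.+ n) /2⌋ ≡ n
  half-odd zero    = refl
  half-odd (suc n) = trans (cong (λ m → ⌊ suc (suc m) /2⌋) (+-suc n n)) (cong suc (half-odd n))

  step-even : ∀ k → let n = suc (suc k) in parity n ≡ 0ℙ →
              stern n ≡ ℤ[t].indeterminate ℤ[t].* stern ⌊ n /2⌋
  step-even k eq = trans (stern-unfold (suc (suc k))) (branch k eq)
    where
    branch : ∀ k → let n = suc (suc k) in parity n ≡ 0ℙ →
             sternStep n (λ {m} _ → stern m) ≡ ℤ[t].indeterminate ℤ[t].* stern ⌊ n /2⌋
    branch k eq with parity k
    branch k refl | 0ℙ = refl

  step-odd : ∀ k → let n = suc (suc k) in parity n ≡ 1ℙ →
             stern n ≡ stern ⌊ n /2⌋ ℤ[t].+ stern ⌈ n /2⌉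
  step-odd k eq = trans (stern-unfold (suc (suc k))) (branch k eq)
    where
    branch : ∀ k → let n = suc (suc k) in parity n ≡ 1ℙ →
             sternStep n (λ {m} _ → stern m) ≡ stern ⌊ n /2⌋ ℤ[t].+ stern ⌈ n /2⌉
    branch k eq with parity k
    branch k refl | 1ℙ = refl

stern-0 : stern 0 ≡ RawRing.0# ℤ[t].rawRing
stern-0 = refl

stern-1 : stern 1 ≡ RawRing.1# ℤ[t].rawRing
stern-1 = refl

stern-even : ∀ n → .{{NonZero n}} →
             stern (2 ℕ.* n) ≡ ℤ[t].indeterminate ℤ[t].* stern n
stern-even n@(suc k) = begin
  stern (2 ℕ.* n)        ≡⟨ cong stern even ⟩
  stern (suc (suc j))    ≡⟨ step-even j (trans (cong parity (sym even′)) (parity-even n)) ⟩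
  ℤ[t].indeterminate ℤ[t].* stern ⌊ suc (suc j) /2⌋
    ≡⟨ cong (λ m → ℤ[t].indeterminate ℤ[t].* stern m)
         (trans (cong ⌊_/2⌋ (sym even′)) (half-even n)) ⟩
  ℤ[t].indeterminate ℤ[t].* stern n ∎
  where
  open ≡-Reasoning
  j : ℕ
  j = k ℕ.+ k
  even′ : n ℕ.+ n ≡ suc (suc j)
  even′ = cong suc (+-suc k k)
  even : 2 ℕ.* n ≡ suc (suc j)
  even = trans (double n) even′

stern-odd : ∀ n → .{{NonZero n}} →
            stern (suc (2 ℕ.* n)) ≡ stern n ℤ[t].+ stern (suc n)
stern-odd n@(suc k) = begin
  stern (suc (2 ℕ.* n))  ≡⟨ cong (λ m → stern (suc m)) (double n) ⟩
  stern (suc (n ℕ.+ n))  ≡⟨ step-odd (k ℕ.+ n) (parity-odd n) ⟩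
  stern ⌊ suc (n ℕ.+ n) /2⌋ ℤ[t].+ stern (suc ⌊ n ℕ.+ n /2⌋)
    ≡⟨ cong₂ (λ a b → stern a ℤ[t].+ stern (suc b)) (half-odd n) (half-even n) ⟩
  stern n ℤ[t].+ stern (suc n) ∎
  where open ≡-Reasoning

open RawRing ℤ[t,x].rawRing public using (_≈_; _+_; _*_; 1#)
open RawSemiringDefs (RawRing.rawSemiring ℤ[t,x].rawRing) public
  using (_^_; sum; product)

t : ℤ[t,x]
t = ℤ[t,x].constant ℤ[t].indeterminate

x : ℤ[t,x]
x = ℤ[t,x].indeterminate

B : ℕ → ℤ[t,x]
B n = ℤ[t,x].constant (stern n)

∏[0⋯_] : ℕ → (ℕ → ℤ[t,x]) → ℤ[t,x]
∏[0⋯ n ] f = product {suc n} (λ i → f (toℕ i))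

∑[1⋯_] : ℕ → (ℕ → ℤ[t,x]) → ℤ[t,x]
∑[1⋯ n ] f = sum {n} (λ i → f (suc (toℕ i)))

{-# OPTIONS --safe #-}

-- Write Q(y) = 1 + t y + y². Dividing by x, the claim for products of n factors
-- reads ∏ (1 + t y^{2^i} + y^{2^{i+1}}) = A_N(y) + y^N D_N(y) with N = 2^n, where
-- A_N(y) = Σ_{j<N} B_{j+1} y^j and D_N(y) = Σ_{j<N} B_{N-1-j} y^j. The product
-- for n+1 at y is Q(y) times the product for n at y², and the Stern
-- recurrences give, for every N,
--   Q(y) A_N(y²) = A_{2N}(y) + B_N y^{2N}   and   D_{2N}(y) = B_N + Q(y) D_N(y²),
-- so the two terms in B_N cancel.

module Submission where

open import Algebra.Bundles using (CommutativeSemiring)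
open import Algebra.Bundles.Raw using (RawRing)
open import Algebra.Structures using (IsCommutativeMonoid; IsCommutativeSemiring)
open import Algebra.Structures.Biased
  using (isCommutativeMonoidˡ; isCommutativeSemiringˡ)
import Algebra.Properties.CommutativeMonoid.Sum as MonoidSum
import Algebra.Properties.Semiring.Exp as Exp
import Algebra.Properties.Semiring.Sum as SemiringSum
import Algebra.Solver.Ring.NaturalCoefficients.Default as Solver
open import Data.Fin.Base using (Fin; toℕ)
import Data.Integer.Base as ℤ
import Data.Integer.Properties as ℤ
open import Data.List.Base using ([]; _∷_; map)
open import Data.Nat.Base as ℕ using (ℕ; zero; suc; _∸_)
import Data.Nat.Properties as ℕ
open import Level using (Level)
open import Relation.Binary.PropositionalEquality as ≡ using (_≡_)
import Relation.Binary.Reasoning.Setoid as SetoidReasoning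
open import Relation.Binary.Structures using (IsEquivalence)

open import Defs using (module Polynomial)

private variable
  c ℓ : Level

-- Polynomials over a commutative semiring form a commutative semiring.

module PolynomialSemiring (R : RawRing c ℓ)
  (isCommutativeSemiring : IsCommutativeSemiring (RawRing._≈_ R)
    (RawRing._+_ R) (RawRing._*_ R) (RawRing.0# R) (RawRing.1# R))
  where

  private
    module R where
      open RawRing R public using (Carrier; _≈_; _+_; _*_; 0#; 1#)
      open IsCommutativeSemiring isCommutativeSemiring public

    S : CommutativeSemiring _ _
    S = record { isCommutativeSemiring = isCommutativeSemiring }

    module R-Reasoning = SetoidReasoning R.setoid

  open Polynomial R

  coeff-+ : ∀ p q k → coeff (p + q) k R.≈ coeff p k R.+ coeff q k
  coeff-+ []      q       k       = R.sym (R.+-identityˡ _)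
  coeff-+ (a ∷ p) []      k       = R.sym (R.+-identityʳ _)
  coeff-+ (a ∷ p) (b ∷ q) zero    = R.refl
  coeff-+ (a ∷ p) (b ∷ q) (suc k) = coeff-+ p q k

  coeff-scale : ∀ a p k → coeff (map (a R.*_) p) k R.≈ a R.* coeff p k
  coeff-scale a []      k       = R.sym (R.zeroʳ a)
  coeff-scale a (b ∷ p) zero    = R.refl
  coeff-scale a (b ∷ p) (suc k) = coeff-scale a p k

  ≈-isEquivalence : IsEquivalence _≈_
  ≈-isEquivalence = record
    { refl  = λ k → R.refl
    ; sym   = λ p≈q k → R.sym (p≈q k)
    ; trans = λ p≈q q≈r k → R.trans (p≈q k) (q≈r k)
    }

  -- The polynomials are explicit arguments, since `_≈_` unfolds to a statement about coefficients
  -- from which unification cannot recover them.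
  +-cong : ∀ p p′ q q′ → p ≈ p′ → q ≈ q′ → p + q ≈ p′ + q′
  +-cong p p′ q q′ p≈p′ q≈q′ k = begin
    coeff (p + q) k            ≈⟨ coeff-+ p q k ⟩
    coeff p k R.+ coeff q k    ≈⟨ R.+-cong (p≈p′ k) (q≈q′ k) ⟩
    coeff p′ k R.+ coeff q′ k  ≈⟨ coeff-+ p′ q′ k ⟨
    coeff (p′ + q′) k          ∎
    where open R-Reasoning

  +-assoc : ∀ p q r → (p + q) + r ≈ p + (q + r)
  +-assoc []      q       r       k       = R.refl
  +-assoc (a ∷ p) []      r       k       = R.refl
  +-assoc (a ∷ p) (b ∷ q) []      k       = R.refl
  +-assoc (a ∷ p) (b ∷ q) (d ∷ r) zero    = R.+-assoc a b d
  +-assoc (a ∷ p) (b ∷ q) (d ∷ r) (suc k) = +-assoc p q r k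

  +-comm : ∀ p q → p + q ≈ q + p
  +-comm []      []      k       = R.refl
  +-comm []      (b ∷ q) k       = R.refl
  +-comm (a ∷ p) []      k       = R.refl
  +-comm (a ∷ p) (b ∷ q) zero    = R.+-comm a b
  +-comm (a ∷ p) (b ∷ q) (suc k) = +-comm p q k

  +-isCommutativeMonoid : IsCommutativeMonoid _≈_ _+_ []
  +-isCommutativeMonoid = isCommutativeMonoidˡ record
    { isSemigroup = record
      { isMagma = record
        { isEquivalence = ≈-isEquivalence
        ; ∙-cong        = λ {p} {p′} {q} {q′} → +-cong p p′ q q′
        }
      ; assoc = +-assoc
      }
    ; identityˡ = λ p k → R.refl
    ; comm      = +-comm
    }

  -- With `coeff-*-suc`, this is the coefficient form of (a + X p) q = a q + X (p q); it takes the
  -- place of a convolution formula in the proofs below.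
  coeff-*-zero : ∀ a p q → coeff ((a ∷ p) * q) 0 R.≈ a R.* coeff q 0
  coeff-*-zero a p q = begin
    coeff ((a ∷ p) * q) 0               ≈⟨ coeff-+ (map (a R.*_) q) _ 0 ⟩
    coeff (map (a R.*_) q) 0 R.+ R.0#   ≈⟨ R.+-identityʳ _ ⟩
    coeff (map (a R.*_) q) 0            ≈⟨ coeff-scale a q 0 ⟩
    a R.* coeff q 0                     ∎
    where open R-Reasoning

  coeff-*-suc : ∀ a p q k →
    coeff ((a ∷ p) * q) (suc k) R.≈ a R.* coeff q (suc k) R.+ coeff (p * q) k
  coeff-*-suc a p q k = R.trans (coeff-+ (map (a R.*_) q) _ (suc k))
    (R.+-congʳ (coeff-scale a q (suc k)))

  *-congˡ : ∀ p q q′ → q ≈ q′ → p * q ≈ p * q′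
  *-congˡ []      q q′ q≈q′ k       = R.refl
  *-congˡ (a ∷ p) q q′ q≈q′ zero    = begin
    coeff ((a ∷ p) * q) 0   ≈⟨ coeff-*-zero a p q ⟩
    a R.* coeff q 0         ≈⟨ R.*-congˡ (q≈q′ 0) ⟩
    a R.* coeff q′ 0        ≈⟨ coeff-*-zero a p q′ ⟨
    coeff ((a ∷ p) * q′) 0  ∎
    where open R-Reasoning
  *-congˡ (a ∷ p) q q′ q≈q′ (suc k) = begin
    coeff ((a ∷ p) * q) (suc k)
      ≈⟨ coeff-*-suc a p q k ⟩
    a R.* coeff q (suc k) R.+ coeff (p * q) k
      ≈⟨ R.+-cong (R.*-congˡ (q≈q′ (suc k))) (*-congˡ p q q′ q≈q′ k) ⟩
    a R.* coeff q′ (suc k) R.+ coeff (p * q′) k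
      ≈⟨ coeff-*-suc a p q′ k ⟨
    coeff ((a ∷ p) * q′) (suc k) ∎
    where open R-Reasoning

  -- `p * []` computes to a list of zeros as long as `p`, so the law holds only coefficientwise.
  *-zeroʳ : ∀ p → p * [] ≈ []
  *-zeroʳ []      k       = R.refl
  *-zeroʳ (a ∷ p) zero    = R.refl
  *-zeroʳ (a ∷ p) (suc k) = *-zeroʳ p k

  -- The recursion is on the coefficient index, which drops in every recursive call, also in the one
  -- inside `swap`, where the factors have changed places.
  *-comm : ∀ p q → p * q ≈ q * p
  *-comm []      q       k    = R.sym (*-zeroʳ q k)
  *-comm (a ∷ p) []      k    = *-zeroʳ (a ∷ p) k
  *-comm (a ∷ p) (b ∷ q) zero = begin
    coeff ((a ∷ p) * (b ∷ q)) 0  ≈⟨ coeff-*-zero a p (b ∷ q) ⟩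
    a R.* b                      ≈⟨ R.*-comm a b ⟩
    b R.* a                      ≈⟨ coeff-*-zero b q (a ∷ p) ⟨
    coeff ((b ∷ q) * (a ∷ p)) 0  ∎
    where open R-Reasoning
  *-comm (a ∷ p) (b ∷ q) (suc k) = begin
    coeff ((a ∷ p) * (b ∷ q)) (suc k)
      ≈⟨ coeff-*-suc a p (b ∷ q) k ⟩
    a R.* coeff q k R.+ coeff (p * (b ∷ q)) k
      ≈⟨ R.+-congˡ (*-comm p (b ∷ q) k) ⟩
    a R.* coeff q k R.+ coeff ((b ∷ q) * p) k
      ≈⟨ swap k ⟩
    b R.* coeff p k R.+ coeff ((a ∷ p) * q) k
      ≈⟨ R.+-congˡ (*-comm (a ∷ p) q k) ⟩
    b R.* coeff p k R.+ coeff (q * (a ∷ p)) k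
      ≈⟨ coeff-*-suc b q (a ∷ p) k ⟨
    coeff ((b ∷ q) * (a ∷ p)) (suc k) ∎
    where
    open R-Reasoning
    open Solver S
    -- Both sides are the coefficient of a q + b p + X p q, which is symmetric once `p * q` and
    -- `q * p` are known to agree in lower degree.
    swap : ∀ k → a R.* coeff q k R.+ coeff ((b ∷ q) * p) k R.≈
                 b R.* coeff p k R.+ coeff ((a ∷ p) * q) k
    swap zero = begin
      a R.* coeff q 0 R.+ coeff ((b ∷ q) * p) 0
        ≈⟨ R.+-congˡ (coeff-*-zero b q p) ⟩
      a R.* coeff q 0 R.+ b R.* coeff p 0
        ≈⟨ R.+-comm _ _ ⟩
      b R.* coeff p 0 R.+ a R.* coeff q 0
        ≈⟨ R.+-congˡ (coeff-*-zero a p q) ⟨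
      b R.* coeff p 0 R.+ coeff ((a ∷ p) * q) 0 ∎
    swap (suc k) = begin
      a R.* coeff q (suc k) R.+ coeff ((b ∷ q) * p) (suc k)
        ≈⟨ R.+-congˡ (coeff-*-suc b q p k) ⟩
      a R.* coeff q (suc k) R.+ (b R.* coeff p (suc k) R.+ coeff (q * p) k)
        ≈⟨ R.+-congˡ (R.+-congˡ (*-comm q p k)) ⟩
      a R.* coeff q (suc k) R.+ (b R.* coeff p (suc k) R.+ coeff (p * q) k)
        ≈⟨ solve 3 (λ u v w → u :+ (v :+ w) := v :+ (u :+ w)) R.refl _ _ _ ⟩
      b R.* coeff p (suc k) R.+ (a R.* coeff q (suc k) R.+ coeff (p * q) k)
        ≈⟨ R.+-congˡ (coeff-*-suc a p q k) ⟨
      b R.* coeff p (suc k) R.+ coeff ((a ∷ p) * q) (suc k) ∎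

  -- Equal left factors may be lists of different lengths, which does not suit the recursion of
  -- `_*_`; commutativity moves each change to the right factor.
  *-cong : ∀ p p′ q q′ → p ≈ p′ → q ≈ q′ → p * q ≈ p′ * q′
  *-cong p p′ q q′ p≈p′ q≈q′ k = begin
    coeff (p * q) k    ≈⟨ *-congˡ p q q′ q≈q′ k ⟩
    coeff (p * q′) k   ≈⟨ *-comm p q′ k ⟩
    coeff (q′ * p) k   ≈⟨ *-congˡ q′ p p′ p≈p′ k ⟩
    coeff (q′ * p′) k  ≈⟨ *-comm q′ p′ k ⟩
    coeff (p′ * q′) k  ∎
    where open R-Reasoning

  *-distribʳ-+ : ∀ r p q → (p + q) * r ≈ p * r + q * r
  *-distribʳ-+ r []      q       k    = R.refl
  *-distribʳ-+ r (a ∷ p) []      k    =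
    IsCommutativeMonoid.sym +-isCommutativeMonoid
      {(a ∷ p) * r + []} {(a ∷ p) * r}
      (IsCommutativeMonoid.identityʳ +-isCommutativeMonoid ((a ∷ p) * r)) k
  *-distribʳ-+ r (a ∷ p) (b ∷ q) zero = begin
    coeff ((a R.+ b ∷ p + q) * r) 0
      ≈⟨ coeff-*-zero _ (p + q) r ⟩
    (a R.+ b) R.* coeff r 0
      ≈⟨ R.distribʳ _ _ _ ⟩
    a R.* coeff r 0 R.+ b R.* coeff r 0
      ≈⟨ R.+-cong (coeff-*-zero a p r) (coeff-*-zero b q r) ⟨
    coeff ((a ∷ p) * r) 0 R.+ coeff ((b ∷ q) * r) 0
      ≈⟨ coeff-+ ((a ∷ p) * r) ((b ∷ q) * r) 0 ⟨
    coeff ((a ∷ p) * r + (b ∷ q) * r) 0 ∎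
    where open R-Reasoning
  *-distribʳ-+ r (a ∷ p) (b ∷ q) (suc k) = begin
    coeff ((a R.+ b ∷ p + q) * r) (suc k)
      ≈⟨ coeff-*-suc _ (p + q) r k ⟩
    (a R.+ b) R.* rₖ₊₁ R.+ coeff ((p + q) * r) k
      ≈⟨ R.+-congˡ (R.trans (*-distribʳ-+ r p q k) (coeff-+ (p * r) (q * r) k)) ⟩
    (a R.+ b) R.* rₖ₊₁ R.+ (coeff (p * r) k R.+ coeff (q * r) k)
      ≈⟨ solve 5 (λ a b d u v → (a :+ b) :* d :+ (u :+ v) :=
                                (a :* d :+ u) :+ (b :* d :+ v)) R.refl _ _ _ _ _ ⟩
    (a R.* rₖ₊₁ R.+ coeff (p * r) k) R.+ (b R.* rₖ₊₁ R.+ coeff (q * r) k)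
      ≈⟨ R.+-cong (coeff-*-suc a p r k) (coeff-*-suc b q r k) ⟨
    coeff ((a ∷ p) * r) (suc k) R.+ coeff ((b ∷ q) * r) (suc k)
      ≈⟨ coeff-+ ((a ∷ p) * r) ((b ∷ q) * r) (suc k) ⟨
    coeff ((a ∷ p) * r + (b ∷ q) * r) (suc k) ∎
    where
    open R-Reasoning
    open Solver S
    rₖ₊₁ : R.Carrier
    rₖ₊₁ = coeff r (suc k)

  scale-* : ∀ a p q → map (a R.*_) p * q ≈ map (a R.*_) (p * q)
  scale-* a []      q k    = R.refl
  scale-* a (b ∷ p) q zero = begin
    coeff (map (a R.*_) (b ∷ p) * q) 0    ≈⟨ coeff-*-zero _ (map (a R.*_) p) q ⟩
    (a R.* b) R.* coeff q 0               ≈⟨ R.*-assoc _ _ _ ⟩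
    a R.* (b R.* coeff q 0)               ≈⟨ R.*-congˡ (coeff-*-zero b p q) ⟨
    a R.* coeff ((b ∷ p) * q) 0           ≈⟨ coeff-scale a ((b ∷ p) * q) 0 ⟨
    coeff (map (a R.*_) ((b ∷ p) * q)) 0  ∎
    where open R-Reasoning
  scale-* a (b ∷ p) q (suc k) = begin
    coeff (map (a R.*_) (b ∷ p) * q) (suc k)
      ≈⟨ coeff-*-suc _ (map (a R.*_) p) q k ⟩
    (a R.* b) R.* coeff q (suc k) R.+ coeff (map (a R.*_) p * q) k
      ≈⟨ R.+-cong (R.*-assoc _ _ _) (R.trans (scale-* a p q k) (coeff-scale a (p * q) k)) ⟩
    a R.* (b R.* coeff q (suc k)) R.+ a R.* coeff (p * q) k
      ≈⟨ R.distribˡ _ _ _ ⟨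
    a R.* (b R.* coeff q (suc k) R.+ coeff (p * q) k)
      ≈⟨ R.*-congˡ (coeff-*-suc b p q k) ⟨
    a R.* coeff ((b ∷ p) * q) (suc k)
      ≈⟨ coeff-scale a ((b ∷ p) * q) (suc k) ⟨
    coeff (map (a R.*_) ((b ∷ p) * q)) (suc k) ∎
    where open R-Reasoning

  shift-* : ∀ p q → (R.0# ∷ p) * q ≈ R.0# ∷ p * q
  shift-* p q zero    = R.trans (coeff-*-zero R.0# p q) (R.zeroˡ _)
  shift-* p q (suc k) = begin
    coeff ((R.0# ∷ p) * q) (suc k)                    ≈⟨ coeff-*-suc R.0# p q k ⟩
    R.0# R.* coeff q (suc k) R.+ coeff (p * q) k      ≈⟨ R.+-congʳ (R.zeroˡ _) ⟩
    R.0# R.+ coeff (p * q) k                          ≈⟨ R.+-identityˡ _ ⟩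
    coeff (p * q) k                                   ∎
    where open R-Reasoning

  -- Distributivity splits (a q + X (p q)) r; `scale-*` and `shift-*` move a and X outside, and what
  -- is left under X is the claim for the shorter `p`.
  *-assoc : ∀ p q r → (p * q) * r ≈ p * (q * r)
  *-assoc []      q r k = R.refl
  *-assoc (a ∷ p) q r k = begin
    coeff ((map (a R.*_) q + (R.0# ∷ p * q)) * r) k
      ≈⟨ *-distribʳ-+ r (map (a R.*_) q) (R.0# ∷ p * q) k ⟩
    coeff (map (a R.*_) q * r + (R.0# ∷ p * q) * r) k
      ≈⟨ +-cong (map (a R.*_) q * r) (map (a R.*_) (q * r)) ((R.0# ∷ p * q) * r) (R.0# ∷ p * (q * r))
           (scale-* a q r) shifted k ⟩
    coeff (map (a R.*_) (q * r) + (R.0# ∷ p * (q * r))) k ∎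
    where
    open R-Reasoning
    shifted : (R.0# ∷ p * q) * r ≈ R.0# ∷ p * (q * r)
    shifted zero    = shift-* (p * q) r zero
    shifted (suc k) = R.trans (shift-* (p * q) r (suc k)) (*-assoc p q r k)

  *-identityˡ : ∀ p → constant R.1# * p ≈ p
  *-identityˡ p zero    = R.trans (coeff-*-zero R.1# [] p) (R.*-identityˡ _)
  *-identityˡ p (suc k) = begin
    coeff (constant R.1# * p) (suc k)      ≈⟨ coeff-*-suc R.1# [] p k ⟩
    R.1# R.* coeff p (suc k) R.+ R.0#      ≈⟨ R.+-identityʳ _ ⟩
    R.1# R.* coeff p (suc k)               ≈⟨ R.*-identityˡ _ ⟩
    coeff p (suc k)                        ∎
    where open R-Reasoning

  +-*-isCommutativeSemiring :
    IsCommutativeSemiring _≈_ _+_ _*_ [] (constant R.1#)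
  +-*-isCommutativeSemiring = isCommutativeSemiringˡ record
    { +-isCommutativeMonoid = +-isCommutativeMonoid
    ; *-isCommutativeMonoid = isCommutativeMonoidˡ record
      { isSemigroup = record
        { isMagma = record
          { isEquivalence = ≈-isEquivalence
          ; ∙-cong        = λ {p} {p′} {q} {q′} → *-cong p p′ q q′
          }
        ; assoc = *-assoc
        }
      ; identityˡ = *-identityˡ
      ; comm      = *-comm
      }
    ; distribʳ = *-distribʳ-+
    ; zeroˡ    = λ p k → R.refl
    }

  constant-cong : ∀ {a b} → a R.≈ b → constant a ≈ constant b
  constant-cong a≈b zero    = a≈b
  constant-cong a≈b (suc k) = R.refl

  constant-0 : constant R.0# ≈ []
  constant-0 zero    = R.refl
  constant-0 (suc k) = R.refl

  constant-* : ∀ a b → constant a * constant b ≈ constant (a R.* b)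
  constant-* a b zero    = R.+-identityʳ _
  constant-* a b (suc k) = R.refl

-- The identity in an arbitrary commutative semiring.

module SternIdentity (S : CommutativeSemiring c ℓ) where

  open CommutativeSemiring S
  open Exp semiring using (_^_; ^-assocʳ)
  open SemiringSum semiring using (sum; sum-cong-≋; *-distribˡ-sum)
  open MonoidSum *-commutativeMonoid using ()
    renaming (sum to product; sum-cong-≋ to product-cong-≋)
  open Solver S
  open SetoidReasoning setoid

  module _ (t : Carrier) (b : ℕ → Carrier)
    (b-0 : b 0 ≈ 0#) (b-1 : b 1 ≈ 1#)
    -- Doubling is written `n * 2` because `suc n * 2` computes to `suc (suc (n * 2))`, so that sums
    -- of length `N * 2` unfold two terms at a time. At `n = 0` the recurrences read 0 = t 0 and 1 =
    -- 0 + 1.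
    (b-even : ∀ n → b (n ℕ.* 2) ≈ t * b n)
    (b-odd : ∀ n → b (suc (n ℕ.* 2)) ≈ b n + b (suc n))
    where

    -- The exponent in `y ^ 1` makes `Q y` definitionally the factor with index 0 of the product.
    Q : Carrier → Carrier
    Q y = 1# + t * y ^ 1 + y ^ 2

    -- A_N in Horner form is the case `m = 0`. The offset is there because removing the first term
    -- shifts the indices; for D_N, removing it just leaves the sum for N - 1.
    ascending : ℕ → ℕ → Carrier → Carrier
    ascending m zero    y = 0#
    ascending m (suc N) y = b (suc m) + y * ascending (suc m) N y

    descending : ℕ → Carrier → Carrier
    descending zero    y = 0#
    descending (suc N) y = b N + y * descending N y

    -- The boundary term b m, absent from the case m = 0 that matters, makes the
    -- induction on N go through.
    ascending-double : ∀ m N y →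
      Q y * ascending m N (y ^ 2) + b m ≈
      ascending (m ℕ.* 2) (N ℕ.* 2) y + b (m ℕ.+ N) * (y ^ 2) ^ N
    ascending-double m zero y = begin
      Q y * 0# + b m            ≈⟨ +-congʳ (zeroʳ _) ⟩
      0# + b m                  ≈⟨ +-congˡ (*-identityʳ _) ⟨
      0# + b m * 1#             ≡⟨ ≡.cong (λ k → 0# + b k * 1#) (ℕ.+-identityʳ m) ⟨
      0# + b (m ℕ.+ 0) * 1#     ∎
    ascending-double m (suc N) y = begin
      Q y * (b (suc m) + y ^ 2 * a) + b m
        -- Of the three terms of `Q y * b (suc m)`, the first joins `b m` to make an odd-indexed
        -- value, the second makes an even-indexed one, and the third is the boundary term of the
        -- induction hypothesis at `suc m`.
        ≈⟨ solve 5 (λ t y u a v →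
             let y² = y :* (y :* con 1)
                 q = con 1 :+ t :* (y :* con 1) :+ y² in
             q :* (u :+ y² :* a) :+ v :=
             v :+ u :+ y :* (t :* u) :+ y² :* (q :* a :+ u)) refl
             t y (b (suc m)) a (b m) ⟩
      b m + b (suc m) + y * (t * b (suc m)) + y ^ 2 * (Q y * a + b (suc m))
        ≈⟨ +-cong (+-cong (sym (b-odd m)) (*-congˡ (sym (b-even (suc m)))))
                  (*-congˡ (ascending-double (suc m) N y)) ⟩
      b (suc (m ℕ.* 2)) + y * b (suc m ℕ.* 2) + y ^ 2 * (a′ + b (suc m ℕ.+ N) * w)
        ≡⟨ ≡.cong (λ k → b (suc (m ℕ.* 2)) + y * b (suc m ℕ.* 2) + y ^ 2 * (a′ + b k * w))
             (ℕ.+-suc m N) ⟨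
      b (suc (m ℕ.* 2)) + y * b (suc m ℕ.* 2) + y ^ 2 * (a′ + b (m ℕ.+ suc N) * w)
        ≈⟨ solve 6 (λ y u v a b w →
             let y² = y :* (y :* con 1) in
             u :+ y :* v :+ y² :* (a :+ b :* w) :=
             u :+ y :* (v :+ y :* a) :+ b :* (y² :* w)) refl
             y (b (suc (m ℕ.* 2))) (b (suc m ℕ.* 2)) a′ (b (m ℕ.+ suc N)) w ⟩
      b (suc (m ℕ.* 2)) + y * (b (suc m ℕ.* 2) + y * a′) + b (m ℕ.+ suc N) * (y ^ 2 * w) ∎
      where
      a  = ascending (suc m) N (y ^ 2)
      a′ = ascending (suc m ℕ.* 2) (N ℕ.* 2) y
      w  = (y ^ 2) ^ N

    -- In the step from `N` to `suc N`, three copies of `b N` arise: weight 1 from the odd-indexed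
    -- term, t y from the even-indexed one, y² from the induction hypothesis. Together they are
    -- `Q y * b N`.
    descending-double : ∀ N y →
      descending (N ℕ.* 2) y ≈ b N + Q y * descending N (y ^ 2)
    descending-double zero y = begin
      0#              ≈⟨ zeroʳ _ ⟨
      Q y * 0#        ≈⟨ +-identityˡ _ ⟨
      0# + Q y * 0#   ≈⟨ +-congʳ b-0 ⟨
      b 0 + Q y * 0#  ∎
    descending-double (suc N) y = begin
      b (suc (N ℕ.* 2)) + y * (b (N ℕ.* 2) + y * descending (N ℕ.* 2) y)
        ≈⟨ +-cong (b-odd N)
             (*-congˡ (+-cong (b-even N) (*-congˡ (descending-double N y)))) ⟩
      b N + b (suc N) + y * (t * b N + y * (b N + Q y * d))
        ≈⟨ solve 5 (λ t y u v d →
             let y² = y :* (y :* con 1)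
                 q = con 1 :+ t :* (y :* con 1) :+ y² in
             u :+ v :+ y :* (t :* u :+ y :* (u :+ q :* d)) :=
             v :+ q :* (u :+ y² :* d)) refl
             t y (b N) (b (suc N)) d ⟩
      b (suc N) + Q y * (b N + y ^ 2 * d) ∎
      where d = descending N (y ^ 2)

    -- Having `y` range over the whole semiring lets the induction hypothesis be taken at `y ^ 2`,
    -- with no substitution operation on polynomials.
    product-formula : ∀ n y →
      product {n} (λ i → 1# + t * y ^ (2 ℕ.^ toℕ i) + y ^ (2 ℕ.^ suc (toℕ i))) ≈
      ascending 0 (2 ℕ.^ n) y + y ^ (2 ℕ.^ n) * descending (2 ℕ.^ n) y
    product-formula zero y = begin
      1#                                     ≈⟨ b-1 ⟨
      b 1                                    ≈⟨ solve 2 (λ u y → u :=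
                                                  u :+ y :* con 0 :+ (y :* con 1) :* (con 0 :+ y :* con 0))
                                                  refl (b 1) y ⟩
      b 1 + y * 0# + y ^ 1 * (0# + y * 0#)   ≈⟨ +-congˡ (*-congˡ (+-congʳ b-0)) ⟨
      b 1 + y * 0# + y ^ 1 * (b 0 + y * 0#)  ∎
    product-formula (suc n) y = begin
      Q y * product {n} (λ i → 1# + t * y ^ (2 ℕ.^ suc (toℕ i)) + y ^ (2 ℕ.^ suc (suc (toℕ i))))
        ≈⟨ *-congˡ (product-cong-≋ {n} λ i →
             +-cong (+-congˡ (*-congˡ (sym (^-assocʳ y 2 (2 ℕ.^ toℕ i)))))
                    (sym (^-assocʳ y 2 (2 ℕ.^ suc (toℕ i))))) ⟩
      Q y * product {n} (λ i → 1# + t * (y ^ 2) ^ (2 ℕ.^ toℕ i) + (y ^ 2) ^ (2 ℕ.^ suc (toℕ i)))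
        ≈⟨ *-congˡ (product-formula n (y ^ 2)) ⟩
      Q y * (a + w * d)
        -- The zero is inserted to become `b 0`, the boundary term of `ascending-double` at `m = 0`.
        ≈⟨ solve 4 (λ q a w d → q :* (a :+ w :* d) := q :* a :+ con 0 :+ w :* (q :* d))
             refl (Q y) a w d ⟩
      Q y * a + 0# + w * (Q y * d)
        ≈⟨ +-congʳ (+-congˡ b-0) ⟨
      Q y * a + b 0 + w * (Q y * d)
        ≈⟨ +-congʳ (ascending-double 0 N y) ⟩
      ascending 0 (N ℕ.* 2) y + b N * w + w * (Q y * d)
        -- No subtraction is involved: the surplus `b N * w` of the ascending sum is the `b N` that
        -- completes the descending sum of doubled length.
        ≈⟨ solve 4 (λ a u w v → a :+ u :* w :+ w :* v := a :+ w :* (u :+ v))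
             refl _ (b N) w (Q y * d) ⟩
      ascending 0 (N ℕ.* 2) y + w * (b N + Q y * d)
        ≈⟨ +-congˡ (*-cong (^-assocʳ y 2 N) (sym (descending-double N y))) ⟩
      ascending 0 (N ℕ.* 2) y + y ^ (2 ℕ.* N) * descending (N ℕ.* 2) y
        ≡⟨ ≡.cong (λ M → ascending 0 M y + y ^ (2 ℕ.* N) * descending M y) (ℕ.*-comm N 2) ⟩
      ascending 0 (2 ℕ.* N) y + y ^ (2 ℕ.* N) * descending (2 ℕ.* N) y ∎
      where
      N = 2 ℕ.^ n
      a = ascending 0 N (y ^ 2)
      d = descending N (y ^ 2)
      w = (y ^ 2) ^ N

    -- `z` will be the power of `y` to the full length of the sum. It is a separate variable because
    -- it stays fixed while `N` falls and `m` rises in the induction.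
    sum-formula : ∀ m N y z →
      sum {N} (λ i → (b (suc (m ℕ.+ toℕ i)) + b (N ∸ suc (toℕ i)) * z) * y ^ suc (toℕ i)) ≈
      y * (ascending m N y + z * descending N y)
    sum-formula m zero y z =
      solve 2 (λ y z → con 0 := y :* (con 0 :+ z :* con 0)) refl y z
    sum-formula m (suc N) y z = begin
      (b (suc (m ℕ.+ 0)) + b N * z) * y ^ 1 +
        sum {N} (λ i → (b (suc (m ℕ.+ suc (toℕ i))) + b (N ∸ suc (toℕ i)) * z) * y ^ suc (suc (toℕ i)))
        -- The descending index `suc N ∸ suc (suc i)` has already computed to `N ∸ suc i`, so only
        -- the ascending index has to be rewritten.
        ≈⟨ +-cong (reflexive (≡.cong (λ k → (b (suc k) + b N * z) * y ^ 1) (ℕ.+-identityʳ m)))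
                  (trans (sum-cong-≋ {N} pull-y) (sym (*-distribˡ-sum {N} y _))) ⟩
      (b (suc m) + b N * z) * y ^ 1 +
        y * sum {N} (λ i → (b (suc (suc m ℕ.+ toℕ i)) + b (N ∸ suc (toℕ i)) * z) * y ^ suc (toℕ i))
        ≈⟨ +-congˡ (*-congˡ (sum-formula (suc m) N y z)) ⟩
      (b (suc m) + b N * z) * y ^ 1 + y * (y * (a + z * d))
        ≈⟨ solve 6 (λ u v y z a d →
             (u :+ v :* z) :* (y :* con 1) :+ y :* (y :* (a :+ z :* d)) :=
             y :* (u :+ y :* a :+ z :* (v :+ y :* d))) refl
             (b (suc m)) (b N) y z a d ⟩
      y * (b (suc m) + y * a + z * (b N + y * d)) ∎
      where
      a = ascending (suc m) N y
      d = descending N y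
      pull-y : (i : Fin N) →
        (b (suc (m ℕ.+ suc (toℕ i))) + b (N ∸ suc (toℕ i)) * z) * y ^ suc (suc (toℕ i)) ≈
        y * ((b (suc (suc m ℕ.+ toℕ i)) + b (N ∸ suc (toℕ i)) * z) * y ^ suc (toℕ i))
      pull-y i = trans
        (reflexive (≡.cong (λ k → (b (suc k) + b (N ∸ suc (toℕ i)) * z) * y ^ suc (suc (toℕ i)))
          (ℕ.+-suc m (toℕ i))))
        (solve 3 (λ u y v → u :* (y :* v) := y :* (u :* v)) refl _ y (y ^ suc (toℕ i)))

    stern-identity : ∀ n y →
      y * product {n} (λ i → 1# + t * y ^ (2 ℕ.^ toℕ i) + y ^ (2 ℕ.^ suc (toℕ i))) ≈
      sum {2 ℕ.^ n} (λ i →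
        (b (suc (toℕ i)) + b (2 ℕ.^ n ∸ suc (toℕ i)) * y ^ (2 ℕ.^ n)) * y ^ suc (toℕ i))
    stern-identity n y = trans (*-congˡ (product-formula n y))
      (sym (sum-formula 0 (2 ℕ.^ n) y (y ^ (2 ℕ.^ n))))

-- Specialization to ℤ[t,x] and the Stern polynomials.

open import Defs

private
  module ℤ[t]-Semiring = PolynomialSemiring ℤ.+-*-rawRing ℤ.+-*-isCommutativeSemiring
  module ℤ[t,x]-Semiring =
    PolynomialSemiring ℤ[t].rawRing ℤ[t]-Semiring.+-*-isCommutativeSemiring

ℤ[t,x]-commutativeSemiring : CommutativeSemiring _ _
ℤ[t,x]-commutativeSemiring = record
  { isCommutativeSemiring = ℤ[t,x]-Semiring.+-*-isCommutativeSemiring }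

-- Stated up to `_≈_` because at `n = 0` the right side is a list of zeros and the left side is
-- `[]`.
stern-*2 : ∀ n → stern (n ℕ.* 2) ℤ[t].≈ ℤ[t].indeterminate ℤ[t].* stern n
stern-*2 zero        k = ≡.sym (ℤ[t]-Semiring.*-zeroʳ ℤ[t].indeterminate k)
stern-*2 n@(suc _) k = ≡.cong (λ p → ℤ[t].coeff p k)
  (≡.trans (≡.cong stern (ℕ.*-comm n 2)) (stern-even n))

stern-suc-*2 : ∀ n → stern (suc (n ℕ.* 2)) ≡ stern n ℤ[t].+ stern (suc n)
stern-suc-*2 zero      = ≡.refl
stern-suc-*2 n@(suc _) =
  ≡.trans (≡.cong (λ m → stern (suc m)) (ℕ.*-comm n 2)) (stern-odd n)

theorem3p2 : (n : ℕ) →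
    x * ∏[0⋯ n ] (λ i → 1# + t * x ^ (2 ℕ.^ i) + x ^ (2 ℕ.^ suc i))
      ≈ ∑[1⋯ 2 ℕ.^ suc n ] (λ i →
          (B i + B (2 ℕ.^ suc n ∸ i) * x ^ (2 ℕ.^ suc n)) * x ^ i)
-- The range from 0 to `n` has `suc n` factors. `B 1` computes to the unit, whereas `B 0` is a
-- singleton list that equals zero only coefficientwise.
theorem3p2 n = stern-identity t B
  ℤ[t,x]-Semiring.constant-0 (refl {B 1}) B-even B-odd (suc n) x
  where
  open CommutativeSemiring ℤ[t,x]-commutativeSemiring using (refl; reflexive)
  open SternIdentity ℤ[t,x]-commutativeSemiring

  B-even : ∀ n → B (n ℕ.* 2) ≈ t * B n
  B-even n k = ≈ₜ.trans
    {ℤ[t,x].coeff (B (n ℕ.* 2)) k} {ℤ[t,x].coeff (ℤ[t,x].constant tBₙ) k}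
    {ℤ[t,x].coeff (t * B n) k}
    (ℤ[t,x]-Semiring.constant-cong {stern (n ℕ.* 2)} {tBₙ} (stern-*2 n) k)
    (≈ₜ.sym {ℤ[t,x].coeff (t * B n) k} {ℤ[t,x].coeff (ℤ[t,x].constant tBₙ) k}
      (ℤ[t,x]-Semiring.constant-* ℤ[t].indeterminate (stern n) k))
    where
    module ≈ₜ = IsEquivalence ℤ[t]-Semiring.≈-isEquivalence
    tBₙ : ℤ[t]
    tBₙ = ℤ[t].indeterminate ℤ[t].* stern n

  B-odd : ∀ n → B (suc (n ℕ.* 2)) ≈ B n + B (suc n)
  B-odd n = reflexive (≡.cong ℤ[t,x].constant (stern-suc-*2 n))
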